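{- For every pair of integers $t,k\in\mathbb{N}$ there exists $N\in\mathbb{N}$ such that every graph that excludes $P_t$, $\overline{P_t}$, and $R_k$ as induced subgraphs admits a cosplit of size at most $N$ and height at most $4k$.
   Context: $P_t$ is the path on $t$ vertices and $\overline{P_t}$ its complement. The universal threshold graph $R_k$ has vertices $a_1,\dots,a_k,b_1,\dots,b_k$, with edges $a_ib_j$ for all $1\le i\le j\le k$, the $a_i$'s forming a clique, the $b_i$'s an independent set, and no other edges. A cotree of height at most $h$ is a triple $(T,c,f)$ with $T$ a rooted tree of height at most $h$ (max number of edges on a root-to-leaf path), $c$ the constant map from leaves to $\{1\}$, and $f:I(T)\times\{1\}\times\{1\}\to\{0,1\}$ on internal vertices; it defines the graph on the leaves where distinct leaves $u,v$ are adjacent iff $f(u\wedge v,1,1)=1$, $u\wedge v$ being their lowest common ancestor. A cograph of height at most $h$ is a graph defined by a cotree of height at most $h$. A cosplit of a graph $G$ is a partition $\mathscr{P}$ of $V(G)$ such that $G[A]$ is a cograph for every $A\in\mathscr{P}$; its size is $|\mathscr{P}|$ and it has height at most $h$ if every $G[A]$, $A\in\mathscr{P}$, is a cograph of height at most $h$. -}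

module Defs where

open import Data.Nat using (ℕ; zero; suc; _+_; _≡ᵇ_; _≤ᵇ_)
open import Data.Bool using (Bool; true; false; _∨_; _∧_; not)
open import Data.Fin using (Fin; toℕ; splitAt)
open import Data.Fin.Properties using (_≟_)
open import Data.Sum using (_⊎_; inj₁; inj₂)
open import Data.Product using (Σ; _×_; proj₁)
open import Data.List using (length; lookup)
open import Data.List.NonEmpty using (List⁺; toList)
open import Relation.Nullary using (does)
open import Relation.Binary.PropositionalEquality using (_≡_)
open import Function.Definitions using (Injective)
open import Function.Bundles using (_↔_)

record Graph : Set where
  field
    n      : ℕ
    adj    : Fin n → Fin n → Bool
    sym    : ∀ u v → adj u v ≡ adj v u
    irrefl : ∀ v → adj v v ≡ false
open Graph public

IsInducedSubgraph : (m : ℕ) → (Fin m → Fin m → Bool) → Graph → Set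
IsInducedSubgraph m adjH G =
  Σ (Fin m → Fin (n G)) λ φ →
    Injective _≡_ _≡_ φ × (∀ u v → adjH u v ≡ adj G (φ u) (φ v))

pathAdj : (t : ℕ) → Fin t → Fin t → Bool
pathAdj t i j = (suc (toℕ i) ≡ᵇ toℕ j) ∨ (suc (toℕ j) ≡ᵇ toℕ i)

coPathAdj : (t : ℕ) → Fin t → Fin t → Bool
coPathAdj t i j = not (does (i ≟ j)) ∧ not (pathAdj t i j)

-- Universal threshold graph R_k; vertices Fin (k + k), the first k are
-- a_1..a_k (clique), the last k are b_1..b_k (independent), a_i b_j iff i ≤ j.
RAdjSplit : (k : ℕ) → Fin k ⊎ Fin k → Fin k ⊎ Fin k → Bool
RAdjSplit k (inj₁ i) (inj₁ j) = not (does (i ≟ j))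
RAdjSplit k (inj₁ i) (inj₂ j) = toℕ i ≤ᵇ toℕ j
RAdjSplit k (inj₂ j) (inj₁ i) = toℕ i ≤ᵇ toℕ j
RAdjSplit k (inj₂ i) (inj₂ j) = false

RAdj : (k : ℕ) → Fin (k + k) → Fin (k + k) → Bool
RAdj k u v = RAdjSplit k (splitAt k u) (splitAt k v)

data Cotree : ℕ → Set where
  leaf : ∀ {h} → Cotree h
  node : ∀ {h} → Bool → List⁺ (Cotree h) → Cotree (suc h)

data Leaf : ∀ {h} → Cotree h → Set where
  here  : ∀ {h} → Leaf (leaf {h})
  there : ∀ {h} {b : Bool} {cs : List⁺ (Cotree h)}
          (i : Fin (length (toList cs))) → Leaf (lookup (toList cs) i) →
          Leaf (node b cs)

-- Adjacency of the graph defined by the cotree: distinct leaves u, v are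
-- adjacent iff the label of their lowest common ancestor is 1 (true).
-- (A leaf is never adjacent to itself.)
cotreeAdj : ∀ {h} {T : Cotree h} → Leaf T → Leaf T → Bool
cotreeAdj here here = false
cotreeAdj {T = node b cs} (there i x) (there j y) with i ≟ j
... | Relation.Nullary.yes Relation.Binary.PropositionalEquality.refl = cotreeAdj x y
... | Relation.Nullary.no _ = b

IsCographOfHeight≤ : (G : Graph) → (Fin (n G) → Set) → ℕ → Set
IsCographOfHeight≤ G P h =
  Σ (Cotree h) λ T →
    Σ (Leaf T ↔ Σ (Fin (n G)) P) λ e →
      ∀ x y → cotreeAdj x y ≡ adj G (proj₁ (Function.Bundles.Inverse.to e x))
                                   (proj₁ (Function.Bundles.Inverse.to e y))

-- A cosplit of size at most N and height at most h, given as a map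
-- p : V(G) → Fin N whose (nonempty) fibres are the parts.
HasCosplit : (G : Graph) → (N h : ℕ) → Set
HasCosplit G N h =
  Σ (Fin (n G) → Fin N) λ p →
    ∀ v → IsCographOfHeight≤ G (λ u → p u ≡ p v) h

{-# OPTIONS --safe #-}
module Submission where

-- A graph without R_k has no alternating sequence of length 2k, where v₁ dominates all
-- later terms, v₂ is isolated from them, v₃ dominates, and so on.  Induct on the length of
-- the excluded sequence: if no sequence of length m + 1 starts with a dominating vertex,
-- every neighbourhood contains none of length m starting with an isolated one, so it splits
-- into boundedly many cographs with a join at the root of the cotree.  Adding a disjoint
-- union above that root makes this kind of part closed under disjoint union, so the
-- minimum number of parts is the maximum over components, and Gyárfás' argument for
-- P_t-free graphs bounds it for the whole graph at the cost of a single extra level.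
-- The complementary case is symmetric, with P_t replaced by its complement.

open import Defs
open import Data.Nat using (ℕ; zero; suc; _+_; _*_; _≤_; z≤n; s≤s; pred; _≤ᵇ_)
open import Data.Nat.Properties using (+-suc; +-identityʳ; *-comm; *-monoʳ-≤)
open import Data.Product using (Σ; _×_; _,_; proj₁; proj₂)
open import Data.Bool using (Bool; true; false; not)
open import Data.Bool.Properties using (¬-not)
import Data.Bool.Properties as Bool
open import Data.Empty using (⊥; ⊥-elim)
open import Data.Unit using (⊤; tt)
open import Data.Fin using (Fin; zero; suc; toℕ; splitAt; _↑ˡ_; _↑ʳ_; join)
open import Data.Fin.Properties
  using (_≟_; suc-injective; ↑ˡ-injective; ↑ʳ-injective; splitAt-↑ˡ; splitAt-↑ʳ; join-splitAt)
open import Data.List using (List; []; _∷_; length; lookup; filter; map; allFin)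
open import Data.List.NonEmpty using (_∷_)
open import Data.List.Membership.Propositional using (_∈_; _∉_; find; lose)
open import Data.List.Membership.Propositional.Properties
  using (∈-filter⁺; ∈-filter⁻; ∈-lookup; ∈-map⁺; ∈-allFin)
open import Data.List.Properties using (≡-dec; ∷-injective)
open import Data.List.Relation.Binary.Subset.Propositional using (_⊆_)
open import Data.List.Relation.Binary.Subset.Propositional.Properties using (filter⁺′)
open import Data.List.Relation.Unary.All using (All; []; _∷_)
import Data.List.Relation.Unary.All as All
open import Data.List.Relation.Unary.Any using (Any; here; there; any?)
open import Data.Sum using (_⊎_; inj₁; inj₂; [_,_]′)
open import Data.Vec using (Vec; []; _∷_; head; tail; replicate)
open import Function using (_∘_; id)
open import Function.Bundles using (mk↔ₛ′)
open import Function.Definitions using (Injective)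
open import Relation.Binary.Construct.Closure.ReflexiveTransitive using (Star; ε; _◅_; _◅◅_; reverse)
import Relation.Binary.Construct.Closure.ReflexiveTransitive as Star
open import Relation.Binary.PropositionalEquality
  using (_≡_; _≢_; refl; trans; cong; cong₂; subst) renaming (sym to ≡-sym)
open import Relation.Nullary using (¬_; Dec; yes; no; contradiction; ¬?; _×-dec_; _⊎-dec_)
open import Relation.Unary using (Decidable)
open import Axiom.UniquenessOfIdentityProofs using (module Decidable⇒UIP)

-- Bounds on the number of parts.

-- As in `Split`, bounds count the parts minus one. Here `j` is the number of vertices by which an
-- induced path falls short of `t`; each prolongation costs the `c + 1` parts of one neighbourhood.
path-bound : ℕ → ℕ → ℕ
path-bound c zero    = zero
path-bound c (suc j) = c + suc (path-bound c j)

-- The outer `suc` pays for the start vertex of the path, a part of its own; being the first vertex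
-- of the path, it leaves `pred t` to go.
colours : ℕ → ℕ → ℕ
colours t zero    = zero
colours t (suc m) = suc (path-bound (colours t m) (pred t))

module _ (G : Graph) where

  -- Relations, alternating sequences and splits.

  V : Set
  V = Fin (n G)

  -- Keys name the children of a cotree node. They are lists so that a class representative can be
  -- prepended to an existing key.
  Key : Set
  Key = List V

  _≟ₖ_ : (k l : Key) → Dec (k ≡ l)
  _≟ₖ_ = ≡-dec _≟_

  -- `E false` is adjacency in the complement, so one argument parametrised by `e` serves both
  -- graphs.
  E : Bool → V → V → Set
  E e u v = u ≢ v × adj G u v ≡ e

  E? : ∀ e u v → Dec (E e u v)
  E? e u v = ¬? (u ≟ v) ×-dec (adj G u v Bool.≟ e)

  E-sym : ∀ {e u v} → E e u v → E e v u
  E-sym {u = u} {v} (u≢v , a) = u≢v ∘ ≡-sym , trans (sym G v u) a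

  ¬E⇒adj : ∀ {e u v} → u ≢ v → ¬ E e u v → adj G u v ≡ not e
  ¬E⇒adj u≢v ¬e = ¬-not (λ a → ¬e (u≢v , a))

  N : Bool → V → List V → List V
  N e v = filter (E? e v)

  -- Alternating sequences v₁, v₂, … in S: v₁ is e-related to all later terms, v₂ is
  -- (not e)-related to all later terms, and so on.  R_k is such a sequence of length 2k.
  Alt : Bool → ℕ → List V → Set
  Alt e zero    S = ⊤
  Alt e (suc m) S = Σ V λ v → v ∈ S × Alt (not e) m (N e v S)

  -- Adjacency read off two leaf addresses: the levels of the cotree carry alternately the
  -- labels b, not b, …, and the lowest common ancestor is at the first difference.
  Codes : Bool → ∀ {h} → Vec Key h → Vec Key h → V → V → Set
  Codes b []       []       u v = ⊥
  Codes b (x ∷ xs) (y ∷ ys) u v =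
    (x ≡ y → Codes (not b) xs ys u v) × (x ≢ y → adj G u v ≡ b)

  -- m counts the parts minus one, so that the part map exists even when S is empty.
  record Split (b : Bool) (h m : ℕ) (S : List V) : Set where
    field
      part  : V → Fin (suc m)
      code  : V → Vec Key h
      codes : ∀ {u v} → u ∈ S → v ∈ S → u ≢ v → part u ≡ part v →
              Codes b (code u) (code v) u v
  open Split

  -- Operations on splits.

  restrict : ∀ {b h m S S′} → S ⊆ S′ → Split b h m S′ → Split b h m S
  restrict S⊆ s = record
    { part = part s ; code = code s ; codes = λ u∈ v∈ → codes s (S⊆ u∈) (S⊆ v∈) }

  subsingleton-split : ∀ {b h m S} → (∀ {u v} → u ∈ S → v ∈ S → u ≡ v) → Split b h m S
  subsingleton-split {h = h} S≡ = record
    { part  = λ _ → zero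
    ; code  = λ _ → replicate h []
    ; codes = λ u∈ v∈ u≢v _ → contradiction (S≡ u∈ v∈) u≢v }

  -- The common first key `[]` puts a root with a single child on top; its label comes into play
  -- only when `class-split` refines that key.
  raise-split : ∀ {b h m S} → Split (not b) h m S → Split b (suc h) m S
  raise-split s = record
    { part  = part s
    ; code  = λ u → [] ∷ code s u
    ; codes = λ u∈ v∈ u≢v p≡ → (λ _ → codes s u∈ v∈ u≢v p≡) , λ k≢k → contradiction refl k≢k }

  -- The two sides use disjoint part names, so codes from different sides are never compared. Both
  -- counts being parts minus one, the sum is `c + suc m`.
  union-split : ∀ {b h c m S} {P : V → Set} (P? : Decidable P) →
    Split b h c (filter P? S) → Split b h m (filter (¬? ∘ P?) S) → Split b h (c + suc m) S
  union-split {b} {h} {c} {m} {S} {P} P? s r = record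
    { part  = λ u → part′ u (P? u)
    ; code  = λ u → code′ u (P? u)
    ; codes = λ {u} {v} u∈ v∈ → codes′ u∈ v∈ (P? u) (P? v) }
    where
    part′ : ∀ u → Dec (P u) → Fin (suc c + suc m)
    part′ u (yes _) = part s u ↑ˡ suc m
    part′ u (no _)  = suc c ↑ʳ part r u

    code′ : ∀ u → Dec (P u) → Vec Key h
    code′ u (yes _) = code s u
    code′ u (no _)  = code r u

    ↑ˡ≢↑ʳ : ∀ (i : Fin (suc c)) (j : Fin (suc m)) → i ↑ˡ suc m ≢ suc c ↑ʳ j
    ↑ˡ≢↑ʳ i j eq with () ← trans (≡-sym (splitAt-↑ˡ (suc c) i (suc m)))
                             (trans (cong (splitAt (suc c)) eq) (splitAt-↑ʳ (suc c) (suc m) j))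

    codes′ : ∀ {u v} → u ∈ S → v ∈ S → (du : Dec (P u)) (dv : Dec (P v)) → u ≢ v →
             part′ u du ≡ part′ v dv → Codes b (code′ u du) (code′ v dv) u v
    codes′ u∈ v∈ (yes p) (yes q) u≢v eq =
      codes s (∈-filter⁺ P? u∈ p) (∈-filter⁺ P? v∈ q) u≢v (↑ˡ-injective (suc m) _ _ eq)
    codes′ u∈ v∈ (no p) (no q) u≢v eq =
      codes r (∈-filter⁺ (¬? ∘ P?) u∈ p) (∈-filter⁺ (¬? ∘ P?) v∈ q) u≢v (↑ʳ-injective (suc c) _ _ eq)
    codes′ u∈ v∈ (yes p) (no q) u≢v eq = contradiction eq (↑ˡ≢↑ʳ _ _)
    codes′ u∈ v∈ (no p) (yes q) u≢v eq = contradiction (≡-sym eq) (↑ˡ≢↑ʳ _ _)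

  class : (V → V) → V → List V → List V
  class f r = filter (λ u → f u ≟ r)

  -- The class is merged into the first key, so the disjoint union costs no extra level.
  class-split : ∀ {e h m S} (f : V → V) →
    (∀ {u v} → u ∈ S → v ∈ S → E e u v → f u ≡ f v) →
    (∀ r → Split (not e) (suc h) m (class f r S)) → Split (not e) (suc h) m S
  class-split {e} {h} {m} {S} f f-resp s = record
    { part  = λ u → part (s (f u)) u
    ; code  = λ u → (f u ∷ head (code (s (f u)) u)) ∷ tail (code (s (f u)) u)
    ; codes = λ {u} {v} u∈ v∈ u≢v p≡ →
        (λ k≡ → same u∈ v∈ u≢v refl (≡-sym (proj₁ (∷-injective k≡))) p≡ refl .proj₁ (proj₂ (∷-injective k≡)))
      , (λ k≢ → distinct u∈ v∈ u≢v p≡ k≢ (f u ≟ f v)) }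
    where
    Tails : V → V → V → V → Set
    Tails u v r q =
      (head (code (s r) u) ≡ head (code (s q) v) →
         Codes (not (not e)) (tail (code (s r) u)) (tail (code (s q) v)) u v)
      × (head (code (s r) u) ≢ head (code (s q) v) → adj G u v ≡ not e)

    -- The classes are variables `r` and `q` because an equation `f u ≡ f v` cannot be matched on
    -- directly.
    same : ∀ {u v r q} → u ∈ S → v ∈ S → u ≢ v → f u ≡ r → q ≡ r →
           part (s r) u ≡ part (s q) v → f v ≡ q → Tails u v r q
    same {u} {v} {r} u∈ v∈ u≢v refl refl p≡ fv
      with code (s r) u | code (s r) v
         | codes (s r) (∈-filter⁺ (λ u → f u ≟ r) u∈ refl)
             (∈-filter⁺ (λ u → f u ≟ r) v∈ fv) u≢v p≡
    ... | x ∷ xs | y ∷ ys | c = c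

    distinct : ∀ {u v} → u ∈ S → v ∈ S → u ≢ v → part (s (f u)) u ≡ part (s (f v)) v →
               (f u ∷ head (code (s (f u)) u)) ≢ (f v ∷ head (code (s (f v)) v)) →
               Dec (f u ≡ f v) → adj G u v ≡ not e
    distinct u∈ v∈ u≢v p≡ k≢ (no f≢)  = ¬E⇒adj u≢v (f≢ ∘ f-resp u∈ v∈)
    distinct u∈ v∈ u≢v p≡ k≢ (yes f≡) =
      same u∈ v∈ u≢v refl (≡-sym f≡) p≡ refl .proj₂ (λ h≡ → k≢ (cong₂ _∷_ f≡ h≡))

  -- Connected components.

  Edge : Bool → List V → V → V → Set
  Edge e S u v = u ∈ S × v ∈ S × E e u v

  Connected : Bool → List V → Set
  Connected e S = ∀ {u v} → u ∈ S → v ∈ S → Star (Edge e S) u v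

  Edge-sym : ∀ {e S u v} → Edge e S u v → Edge e S v u
  Edge-sym (u∈ , v∈ , a) = v∈ , u∈ , E-sym a

  -- `comp` chooses representatives. Keeping them inside `S` makes a vertex outside `S` a fresh
  -- representative in `add-vertex`.
  record Components (e : Bool) (S : List V) : Set where
    field
      comp      : V → V
      comp∈     : ∀ {u} → u ∈ S → comp u ∈ S
      comp-edge : ∀ {u v} → u ∈ S → v ∈ S → E e u v → comp u ≡ comp v
      comp-walk : ∀ {u v} → u ∈ S → v ∈ S → comp u ≡ comp v → Star (Edge e S) u v
  open Components

  -- Adding a vertex x merges all the components that meet its neighbourhood.
  add-vertex : ∀ {e S x} → x ∉ S → Components e S → Components e (x ∷ S)
  add-vertex {e} {S} {x} x∉ K = record
    { comp      = λ u → comp′ u (touch? u)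
    ; comp∈     = λ {u} → comp′∈ (touch? u)
    ; comp-edge = λ {u} {v} → comp′-edge (touch? u) (touch? v)
    ; comp-walk = λ {u} {v} → comp′-walk (touch? u) (touch? v) }
    where
    Touch : V → Set
    Touch u = (u ≡ x) ⊎ Any (λ z → comp K z ≡ comp K u × E e x z) S

    touch? : ∀ u → Dec (Touch u)
    touch? u = (u ≟ x) ⊎-dec any? (λ z → (comp K z ≟ comp K u) ×-dec E? e x z) S

    comp′ : ∀ u → Dec (Touch u) → V
    comp′ u (yes _) = x
    comp′ u (no _)  = comp K u

    old : ∀ {u} → ¬ Touch u → u ∈ x ∷ S → u ∈ S
    old ¬t (here u≡x) = contradiction (inj₁ u≡x) ¬t
    old ¬t (there u∈) = u∈

    comp′∈ : ∀ {u} (d : Dec (Touch u)) → u ∈ x ∷ S → comp′ u d ∈ x ∷ S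
    comp′∈ (yes _) u∈ = here refl
    comp′∈ (no ¬t) u∈ = there (comp∈ K (old ¬t u∈))

    touch-edge : ∀ {u v} → Touch u → u ∈ x ∷ S → v ∈ x ∷ S → E e u v → Touch v
    touch-edge t u∈ (here v≡x) a = inj₁ v≡x
    touch-edge (inj₁ refl) u∈ (there v∈) a = inj₂ (lose v∈ (refl , a))
    touch-edge (inj₂ t) (here refl) (there v∈) a = inj₂ (lose v∈ (refl , a))
    touch-edge (inj₂ t) (there u∈) (there v∈) a with find t
    ... | z , z∈ , cz≡ , xz = inj₂ (lose z∈ (trans cz≡ (comp-edge K u∈ v∈ a) , xz))

    comp′-edge : ∀ {u v} (d : Dec (Touch u)) (d′ : Dec (Touch v)) → u ∈ x ∷ S → v ∈ x ∷ S →
                 E e u v → comp′ u d ≡ comp′ v d′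
    comp′-edge (yes _) (yes _) u∈ v∈ a = refl
    comp′-edge (no ¬t) (no ¬t′) u∈ v∈ a = comp-edge K (old ¬t u∈) (old ¬t′ v∈) a
    comp′-edge (yes t) (no ¬t′) u∈ v∈ a = contradiction (touch-edge t u∈ v∈ a) ¬t′
    comp′-edge (no ¬t) (yes t′) u∈ v∈ a = contradiction (touch-edge t′ v∈ u∈ (E-sym a)) ¬t

    weaken : ∀ {u v} → Star (Edge e S) u v → Star (Edge e (x ∷ S)) u v
    weaken = Star.map (λ (u∈ , v∈ , a) → there u∈ , there v∈ , a)

    walk-to-x : ∀ {u} → Touch u → u ∈ x ∷ S → Star (Edge e (x ∷ S)) u x
    walk-to-x t (here refl) = ε
    walk-to-x (inj₁ refl) u∈ = ε
    walk-to-x (inj₂ t) (there u∈) with find t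
    ... | z , z∈ , cz≡ , xz =
      weaken (comp-walk K u∈ z∈ (≡-sym cz≡)) ◅◅ (there z∈ , here refl , E-sym xz) ◅ ε

    comp′-walk : ∀ {u v} (d : Dec (Touch u)) (d′ : Dec (Touch v)) → u ∈ x ∷ S → v ∈ x ∷ S →
                 comp′ u d ≡ comp′ v d′ → Star (Edge e (x ∷ S)) u v
    comp′-walk (yes t) (yes t′) u∈ v∈ _ = walk-to-x t u∈ ◅◅ reverse Edge-sym (walk-to-x t′ v∈)
    comp′-walk (no ¬t) (no ¬t′) u∈ v∈ c≡ = weaken (comp-walk K (old ¬t u∈) (old ¬t′ v∈) c≡)
    comp′-walk (yes t) (no ¬t′) u∈ v∈ c≡ =
      contradiction (subst (_∈ S) (≡-sym c≡) (comp∈ K (old ¬t′ v∈))) x∉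
    comp′-walk (no ¬t) (yes t′) u∈ v∈ c≡ =
      contradiction (subst (_∈ S) c≡ (comp∈ K (old ¬t u∈))) x∉

  add-member : ∀ {e S x} → x ∈ S → Components e S → Components e (x ∷ S)
  add-member {S = S} {x} x∈ K = record
    { comp      = comp K
    ; comp∈     = there ∘ comp∈ K ∘ old
    ; comp-edge = λ u∈ v∈ → comp-edge K (old u∈) (old v∈)
    ; comp-walk = λ u∈ v∈ c≡ →
        Star.map (λ (u∈ , v∈ , a) → there u∈ , there v∈ , a) (comp-walk K (old u∈) (old v∈) c≡) }
    where
    old : ∀ {u} → u ∈ x ∷ S → u ∈ S
    old (here refl) = x∈
    old (there u∈)  = u∈

  components : ∀ e S → Components e S
  components e [] = record { comp = id ; comp∈ = λ () ; comp-edge = λ () ; comp-walk = λ () }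
  components e (x ∷ S) with any? (x ≟_) S
  ... | yes x∈ = add-member x∈ (components e S)
  ... | no  x∉ = add-vertex x∉ (components e S)

  Closed : Bool → List V → List V → Set
  Closed e C S = ∀ {u v} → u ∈ C → v ∈ S → E e u v → v ∈ C

  -- All components reuse the same part names, so `m` does not grow with their number.
  component-split : ∀ {e h m S} →
    (∀ {C u} → u ∈ C → C ⊆ S → Connected e C → Closed e C S → Split (not e) (suc h) m C) →
    Split (not e) (suc h) m S
  component-split {e} {h} {m} {S} s = class-split (comp K) (comp-edge K) (λ r → by-class r _ refl)
    where
    K = components e S

    class⁻ : ∀ {r u} → u ∈ class (comp K) r S → u ∈ S × comp K u ≡ r
    class⁻ {r} = ∈-filter⁻ (λ u → comp K u ≟ r)

    closed : ∀ r → Closed e (class (comp K) r S) S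
    closed r u∈ v∈ a with class⁻ u∈
    ... | u∈S , cu≡ = ∈-filter⁺ (λ u → comp K u ≟ r) v∈
                        (trans (≡-sym (comp-edge K u∈S v∈ a)) cu≡)

    walk : ∀ r {u v} → u ∈ class (comp K) r S → Star (Edge e S) u v →
           Star (Edge e (class (comp K) r S)) u v
    walk r u∈ ε = ε
    walk r u∈ ((_ , w∈ , a) ◅ p) = (u∈ , closed r u∈ w∈ a , a) ◅ walk r (closed r u∈ w∈ a) p

    connected : ∀ r → Connected e (class (comp K) r S)
    connected r u∈ v∈ = walk r u∈
      (comp-walk K (proj₁ (class⁻ u∈)) (proj₁ (class⁻ v∈))
        (trans (proj₂ (class⁻ u∈)) (≡-sym (proj₂ (class⁻ v∈)))))

    -- `class-split` asks for every `r`, including those that represent nothing. An empty class is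
    -- split trivially; any other supplies the member `u`.
    by-class : ∀ r L → L ≡ class (comp K) r S → Split (not e) (suc h) m (class (comp K) r S)
    by-class r [] eq = subst (Split _ _ _) eq (subsingleton-split (λ ()))
    by-class r (u ∷ L) eq =
      s (subst (u ∈_) eq (here refl)) (proj₁ ∘ class⁻) (connected r) (closed r)

  -- By closedness the walk stays in `C` as long as it avoids `P`, so the first `P`-vertex on it is
  -- joined to a vertex of `C`.
  crossing : ∀ {e C S} {P : V → Set} (P? : Decidable P) →
    C ⊆ filter (¬? ∘ P?) S → Closed e C (filter (¬? ∘ P?) S) →
    ∀ {u v} → u ∈ C → P v → Star (Edge e S) u v →
    Σ V λ x → Σ V λ y → x ∈ S × P x × y ∈ C × E e x y
  crossing {S = S} P? C⊆ closed u∈ Pv ε = contradiction Pv (proj₂ (∈-filter⁻ (¬? ∘ P?) {xs = S} (C⊆ u∈)))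
  crossing P? C⊆ closed {u} u∈ Pv ((_ , w∈ , a) ◅ p) with P? _
  ... | yes Pw = _ , u , w∈ , Pw , u∈ , E-sym a
  ... | no ¬Pw = crossing P? C⊆ closed (closed u∈ (∈-filter⁺ (¬? ∘ P?) w∈ ¬Pw) a) Pv p

  -- Induced paths and Gyárfás' argument.

  Far : Bool → V → V → Set
  Far e u v = u ≢ v × ¬ E e u v

  -- The head of the list is the end that gets prolonged. For `e = false` this is an induced path of
  -- the complement.
  data InducedPath (e : Bool) : List V → Set where
    []  : InducedPath e []
    [_] : ∀ v → InducedPath e (v ∷ [])
    _∷_ : ∀ {u v vs} → E e u v × All (Far e u) vs → InducedPath e (v ∷ vs) →
          InducedPath e (u ∷ v ∷ vs)

  module Gyarfas (t : ℕ) (e : Bool)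
    (no-path : ∀ {vs} → InducedPath e vs → length vs ≢ t)
    {h c : ℕ} {S₀ : List V}
    (nbhd-split : ∀ {v} → v ∈ S₀ → Split (not e) (suc h) c (N e v S₀))
    where

    -- v is the end of the path and S a piece attached to the path only at v.  A component of
    -- S minus the neighbours of v is attached to one of these, which prolongs the path.
    extend : ∀ j {v vs S} → InducedPath e (v ∷ vs) → length (v ∷ vs) + j ≡ t →
      v ∈ S₀ → S ⊆ S₀ → Connected e S → (∀ {u} → u ∈ S → u ≢ v × All (Far e u) vs) →
      (Σ V λ y → y ∈ S × E e v y) → Split (not e) (suc h) (path-bound c j) S
    extend zero {v} {vs} path len v∈ S⊆ conn far y =
      ⊥-elim (no-path path (trans (≡-sym (+-identityʳ _)) len))
    extend (suc j) {v} {vs} {S} path len v∈ S⊆ conn far (y , y∈ , vy) =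
      union-split (E? e v)
        (restrict (filter⁺′ (E? e v) (E? e v) id S⊆) (nbhd-split v∈))
        (component-split on-component)
      where
      W = filter (¬? ∘ E? e v) S

      W⁻ : ∀ {u} → u ∈ W → u ∈ S × ¬ E e v u
      W⁻ = ∈-filter⁻ (¬? ∘ E? e v)

      on-component : ∀ {C u} → u ∈ C → C ⊆ W → Connected e C → Closed e C W →
                     Split (not e) (suc h) (path-bound c j) C
      on-component u∈ C⊆ connC closed
        -- Connectedness of `S` gives a walk from the component to the neighbour `y` of `v`; where
        -- it first meets the neighbourhood of `v` lies the new end `x`.
        with crossing (E? e v) C⊆ closed u∈ vy (conn (proj₁ (W⁻ (C⊆ u∈))) y∈)
      ... | x , z , x∈ , vx , z∈ , xz =
        extend j ((E-sym vx , proj₂ (far x∈)) ∷ path) (trans (cong suc (≡-sym (+-suc _ j))) len)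
          (S⊆ x∈) (S⊆ ∘ proj₁ ∘ W⁻ ∘ C⊆) connC
          -- Members of `C` are not neighbours of `v`: they differ from the neighbour `x`, and `v`
          -- can join the vertices they are far from.
          (λ {w} w∈ → let (w∈S , ¬vw) = W⁻ (C⊆ w∈) in
            (λ { refl → ¬vw vx })
            , (proj₁ (far w∈S) , ¬vw ∘ E-sym) ∷ proj₂ (far w∈S))
          (z , z∈ , xz)

    -- With `v` set apart as a single part, every component of the rest is attached to `v` by
    -- connectedness, and `extend` starts from the one-vertex path.
    from-vertex : ∀ {j C v} → 1 + j ≡ t → v ∈ C → C ⊆ S₀ → Connected e C →
                  Split (not e) (suc h) (suc (path-bound c j)) C
    from-vertex {j} {C} {v} len v∈ C⊆ conn =
      union-split {c = zero} is-v?
        (subsingleton-split λ u∈ w∈ → trans (proj₂ (∈-filter⁻ is-v? {xs = C} u∈))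
                                            (≡-sym (proj₂ (∈-filter⁻ is-v? {xs = C} w∈))))
        (component-split on-component)
      where
      is-v? : Decidable (_≡ v)
      is-v? = _≟ v

      W = filter (¬? ∘ is-v?) C

      W⁻ : ∀ {u} → u ∈ W → u ∈ C × u ≢ v
      W⁻ = ∈-filter⁻ (¬? ∘ is-v?)

      on-component : ∀ {D u} → u ∈ D → D ⊆ W → Connected e D → Closed e D W →
                     Split (not e) (suc h) (path-bound c j) D
      on-component u∈ D⊆ connD closed
        with crossing is-v? D⊆ closed u∈ refl (conn (proj₁ (W⁻ (D⊆ u∈))) v∈)
      ... | _ , z , _ , refl , z∈ , vz =
        extend j [ v ] len (C⊆ v∈) (C⊆ ∘ proj₁ ∘ W⁻ ∘ D⊆) connD
          (λ w∈ → proj₂ (W⁻ (D⊆ w∈)) , []) (z , z∈ , vz)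

    gyarfas : Split (not e) (suc h) (suc (path-bound c (pred t))) S₀
    gyarfas = by-length t refl
      where
      by-length : ∀ s → s ≡ t → Split (not e) (suc h) (suc (path-bound c (pred s))) S₀
      -- For `t = 0` the empty path is already excluded.
      by-length zero    len = contradiction len (no-path [])
      by-length (suc j) len = component-split λ v∈ C⊆ conn _ → from-vertex len v∈ C⊆ conn

  -- The induction on alternating sequences.

  -- Prepending `v` to a sequence in `N e v S` would give one in `S`, so induction applies to every
  -- neighbourhood with `e` flipped; hence `no-path` is required for both values of `e`. Each term
  -- costs one level.
  alt-free-split : ∀ {t} → (∀ {e vs} → InducedPath e vs → length vs ≢ t) →
    ∀ m {e S} → ¬ Alt e m S → Split (not e) m (colours t m) S
  alt-free-split no-path zero    ¬alt = contradiction tt ¬alt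
  alt-free-split {t} no-path (suc m) {e} ¬alt = Gyarfas.gyarfas t e no-path λ {v} v∈ →
    raise-split (alt-free-split no-path m λ alt → ¬alt (v , v∈ , alt))

  Alt-≤ : ∀ {e m m′ S} → m′ ≤ m → Alt e m S → Alt e m′ S
  Alt-≤ z≤n       _              = tt
  Alt-≤ (s≤s m≤m) (v , v∈ , alt) = v , v∈ , Alt-≤ m≤m alt

  -- From vertex lists to induced paths and their complements.

  -- This trichotomy of positions yields injectivity and the adjacencies of both `pathAdj` and
  -- `coPathAdj`.
  data PathPair (e : Bool) {m} (i j : Fin m) (u v : V) : Set where
    consecutive : pathAdj m i j ≡ true → E e u v → PathPair e i j u v
    apart       : pathAdj m i j ≡ false → i ≢ j → Far e u v → PathPair e i j u v
    equal       : i ≡ j → PathPair e i j u v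

  suc-pair : ∀ {e m} {i j : Fin m} {u v} → PathPair e i j u v → PathPair e (suc i) (suc j) u v
  suc-pair (consecutive p a) = consecutive p a
  suc-pair (apart p i≢j f)   = apart p (i≢j ∘ suc-injective) f
  suc-pair (equal refl)      = equal refl

  Far-sym : ∀ {e u v} → Far e u v → Far e v u
  Far-sym (u≢v , ¬a) = u≢v ∘ ≡-sym , ¬a ∘ E-sym

  path-pair : ∀ {e vs} → InducedPath e vs → ∀ i j → PathPair e i j (lookup vs i) (lookup vs j)
  path-pair {vs = _ ∷ _} _ zero zero = equal refl
  path-pair ((a , _) ∷ _) zero (suc zero) = consecutive refl a
  path-pair ((a , _) ∷ _) (suc zero) zero = consecutive refl (E-sym a)
  path-pair ((_ , f) ∷ _) zero (suc (suc j)) =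
    apart refl (λ ()) (All.lookup f (∈-lookup j))
  path-pair ((_ , f) ∷ _) (suc (suc i)) zero =
    apart refl (λ ()) (Far-sym (All.lookup f (∈-lookup i)))
  path-pair (_ ∷ p) (suc i) (suc j) = suc-pair (path-pair p i j)

  lookup-injective : ∀ {e vs} → InducedPath e vs → Injective _≡_ _≡_ (lookup vs)
  lookup-injective p {i} {j} eq with path-pair p i j
  ... | consecutive _ (u≢v , _) = contradiction eq u≢v
  ... | apart _ _ (u≢v , _)     = contradiction eq u≢v
  ... | equal i≡j               = i≡j

  pathAdj-irrefl : ∀ m (i : Fin m) → pathAdj m i i ≡ false
  pathAdj-irrefl (suc m) zero    = refl
  pathAdj-irrefl (suc m) (suc i) = pathAdj-irrefl m i

  coPathAdj-irrefl : ∀ m (i : Fin m) → coPathAdj m i i ≡ false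
  coPathAdj-irrefl (suc m) zero    = refl
  coPathAdj-irrefl (suc m) (suc i) = coPathAdj-irrefl m i

  coPathAdj-≢ : ∀ m {i j : Fin m} → i ≢ j → coPathAdj m i j ≡ not (pathAdj m i j)
  coPathAdj-≢ m {i} {j} i≢j with i ≟ j
  ... | yes i≡j = contradiction i≡j i≢j
  ... | no _    = refl

  path-induced : ∀ {vs} → InducedPath true vs → IsInducedSubgraph (length vs) (pathAdj (length vs)) G
  path-induced {vs} p = lookup vs , lookup-injective p , adj≡
    where
    adj≡ : ∀ i j → pathAdj (length vs) i j ≡ adj G (lookup vs i) (lookup vs j)
    adj≡ i j with path-pair p i j
    ... | consecutive eq (_ , a) = trans eq (≡-sym a)
    ... | apart eq _ (u≢v , ¬a)  = trans eq (≡-sym (¬E⇒adj u≢v ¬a))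
    ... | equal refl             = trans (pathAdj-irrefl _ i) (≡-sym (irrefl G _))

  copath-induced : ∀ {vs} → InducedPath false vs →
                   IsInducedSubgraph (length vs) (coPathAdj (length vs)) G
  copath-induced {vs} p = lookup vs , lookup-injective p , adj≡
    where
    adj≡ : ∀ i j → coPathAdj (length vs) i j ≡ adj G (lookup vs i) (lookup vs j)
    adj≡ i j with path-pair p i j
    ... | consecutive eq (u≢v , a) =
      trans (trans (coPathAdj-≢ _ (u≢v ∘ cong (lookup vs))) (cong not eq)) (≡-sym a)
    ... | apart eq i≢j (u≢v , ¬a)  =
      trans (trans (coPathAdj-≢ _ i≢j) (cong not eq)) (≡-sym (¬E⇒adj u≢v ¬a))
    ... | equal refl               = trans (coPathAdj-irrefl _ i) (≡-sym (irrefl G _))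

  -- Alternating sequences and universal threshold graphs.

  -- Each `E` carries distinctness of its endpoints, which later gives injectivity of the embedding.
  record Threshold (k : ℕ) (S : List V) : Set where
    field
      a b    : Fin k → V
      a∈     : ∀ i → a i ∈ S
      b∈     : ∀ i → b i ∈ S
      a-adj  : ∀ {i j} → i ≢ j → E true (a i) (a j)
      b-adj  : ∀ {i j} → i ≢ j → E false (b i) (b j)
      ab-adj : ∀ i j → E (toℕ i ≤ᵇ toℕ j) (a i) (b j)

  ≤ᵇ-suc : ∀ m n → (suc m ≤ᵇ suc n) ≡ (m ≤ᵇ n)
  ≤ᵇ-suc zero    n = refl
  ≤ᵇ-suc (suc m) n = refl

  -- The terms are read as a₁, b₁, a₂, b₂, and so on: each a dominates and each b is isolated from
  -- what follows. The length is `k * 2` so that it unfolds by two terms at a time.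
  threshold : ∀ k {S} → Alt true (k * 2) S → Threshold k S
  threshold zero _ = record
    { a = λ () ; b = λ () ; a∈ = λ () ; b∈ = λ ()
    ; a-adj = λ {} ; b-adj = λ {} ; ab-adj = λ () }
  threshold (suc k) {S} (v , v∈ , w , w∈ , alt) = record
    { a = a′ ; b = b′ ; a∈ = a′∈ ; b∈ = b′∈
    ; a-adj = a′-adj ; b-adj = b′-adj ; ab-adj = ab′-adj }
    where
    open Threshold (threshold k alt)

    vw : w ∈ S × E true v w
    vw = ∈-filter⁻ (E? true v) w∈

    later : ∀ {u} → u ∈ N false w (N true v S) → u ∈ S × E true v u × E false w u
    later u∈ with ∈-filter⁻ (E? false w) {xs = N true v S} u∈
    ... | u∈N , wu with ∈-filter⁻ (E? true v) {xs = S} u∈N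
    ... | u∈S , vu = u∈S , vu , wu

    a′ b′ : Fin (suc k) → V
    a′ zero    = v
    a′ (suc i) = a i
    b′ zero    = w
    b′ (suc i) = b i

    a′∈ : ∀ i → a′ i ∈ S
    a′∈ zero    = v∈
    a′∈ (suc i) = proj₁ (later (a∈ i))

    b′∈ : ∀ i → b′ i ∈ S
    b′∈ zero    = proj₁ vw
    b′∈ (suc i) = proj₁ (later (b∈ i))

    a′-adj : ∀ {i j} → i ≢ j → E true (a′ i) (a′ j)
    a′-adj {zero}  {zero}  i≢j = contradiction refl i≢j
    a′-adj {zero}  {suc j} _   = proj₁ (proj₂ (later (a∈ j)))
    a′-adj {suc i} {zero}  _   = E-sym (proj₁ (proj₂ (later (a∈ i))))
    a′-adj {suc i} {suc j} i≢j = a-adj (i≢j ∘ cong suc)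

    b′-adj : ∀ {i j} → i ≢ j → E false (b′ i) (b′ j)
    b′-adj {zero}  {zero}  i≢j = contradiction refl i≢j
    b′-adj {zero}  {suc j} _   = proj₂ (proj₂ (later (b∈ j)))
    b′-adj {suc i} {zero}  _   = E-sym (proj₂ (proj₂ (later (b∈ i))))
    b′-adj {suc i} {suc j} i≢j = b-adj (i≢j ∘ cong suc)

    ab′-adj : ∀ i j → E (toℕ i ≤ᵇ toℕ j) (a′ i) (b′ j)
    ab′-adj zero    zero    = proj₂ vw
    ab′-adj zero    (suc j) = proj₁ (proj₂ (later (b∈ j)))
    ab′-adj (suc i) zero    = E-sym (proj₂ (proj₂ (later (a∈ i))))
    ab′-adj (suc i) (suc j) =
      subst (λ e → E e (a i) (b j)) (≡-sym (≤ᵇ-suc (toℕ i) (toℕ j))) (ab-adj i j)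

  threshold-induced : ∀ {k S} → Threshold k S → IsInducedSubgraph (k + k) (RAdj k) G
  threshold-induced {k} T = φ ∘ splitAt k , φ-injective , λ u v → adj≡ (splitAt k u) (splitAt k v)
    where
    open Threshold T

    φ : Fin k ⊎ Fin k → V
    φ = [ a , b ]′

    inj : ∀ x y → φ x ≡ φ y → x ≡ y
    inj (inj₁ i) (inj₁ j) eq with i ≟ j
    ... | yes refl = refl
    ... | no i≢j   = contradiction eq (proj₁ (a-adj i≢j))
    inj (inj₁ i) (inj₂ j) eq = contradiction eq (proj₁ (ab-adj i j))
    inj (inj₂ j) (inj₁ i) eq = contradiction (≡-sym eq) (proj₁ (ab-adj i j))
    inj (inj₂ i) (inj₂ j) eq with i ≟ j
    ... | yes refl = refl
    ... | no i≢j   = contradiction eq (proj₁ (b-adj i≢j))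

    φ-injective : Injective _≡_ _≡_ (φ ∘ splitAt k)
    φ-injective {u} {v} eq =
      trans (≡-sym (join-splitAt k k u))
        (trans (cong (join k k) (inj (splitAt k u) (splitAt k v) eq)) (join-splitAt k k v))

    adj≡ : ∀ x y → RAdjSplit k x y ≡ adj G (φ x) (φ y)
    adj≡ (inj₁ i) (inj₁ j) with i ≟ j
    ... | yes refl = ≡-sym (irrefl G (a i))
    ... | no i≢j   = ≡-sym (proj₂ (a-adj i≢j))
    adj≡ (inj₁ i) (inj₂ j) = ≡-sym (proj₂ (ab-adj i j))
    adj≡ (inj₂ j) (inj₁ i) = ≡-sym (proj₂ (E-sym (ab-adj i j)))
    adj≡ (inj₂ i) (inj₂ j) with i ≟ j
    ... | yes refl = ≡-sym (irrefl G (b i))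
    ... | no i≢j   = ≡-sym (proj₂ (b-adj i≢j))

  -- Cotrees from codes.

  record Represents {h} (T : Cotree h) (L : List V) : Set where
    field
      vertex     : Leaf T → V
      vertex∈    : ∀ x → vertex x ∈ L
      vertex-inj : ∀ {x y} → vertex x ≡ vertex y → x ≡ y
      leaf-of    : ∀ {u} → u ∈ L → Σ (Leaf T) λ x → vertex x ≡ u
      adj≡       : ∀ x y → cotreeAdj x y ≡ adj G (vertex x) (vertex y)
  open Represents

  first : ∀ {h} → (V → Vec Key (suc h)) → Key → List V → List V
  first code k = filter (λ u → head (code u) ≟ₖ k)

  -- The future children of a node: one tree for each key of `ks` that occurs as a first key in `L`.
  record Forest {h} (code : V → Vec Key (suc h)) (L : List V) (ks : List Key) : Set where
    field
      trees   : List (Cotree h)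
      key     : Fin (length trees) → Key
      key∈    : ∀ i → key i ∈ ks
      key-inj : ∀ {i j} → key i ≡ key j → i ≡ j
      rep     : ∀ i → Represents (lookup trees i) (first code (key i) L)
      tree-of : ∀ {u} → u ∈ L → head (code u) ∈ ks → Σ (Fin (length trees)) λ i → key i ≡ head (code u)

  RealisedBy : Bool → ∀ {h} → (V → Vec Key h) → List V → Set
  RealisedBy b code L = ∀ {u v} → u ∈ L → v ∈ L → u ≢ v → Codes b (code u) (code v) u v

  plant : ∀ {h} {code : V → Vec Key (suc h)} {L k ks} → k ∉ ks →
    (Σ (Cotree h) λ T → Represents T (first code k L)) → Forest code L ks → Forest code L (k ∷ ks)
  plant {h} {code} {L} {k} {ks} k∉ (T , R) F = record
    { trees = T ∷ trees ; key = key′ ; key∈ = key′∈ ; key-inj = λ {i} {j} → key′-inj i j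
    ; rep = rep′ ; tree-of = tree-of′ }
    where
    open Forest F

    key′ : Fin (suc (length trees)) → Key
    key′ zero    = k
    key′ (suc i) = key i

    key′∈ : ∀ i → key′ i ∈ k ∷ ks
    key′∈ zero    = here refl
    key′∈ (suc i) = there (key∈ i)

    key′-inj : ∀ i j → key′ i ≡ key′ j → i ≡ j
    key′-inj zero    zero    _  = refl
    key′-inj zero    (suc j) eq = contradiction (subst (_∈ ks) (≡-sym eq) (key∈ j)) k∉
    key′-inj (suc i) zero    eq = contradiction (subst (_∈ ks) eq (key∈ i)) k∉
    key′-inj (suc i) (suc j) eq = cong suc (key-inj eq)

    rep′ : ∀ i → Represents (lookup (T ∷ trees) i) (first code (key′ i) L)
    rep′ zero    = R
    rep′ (suc i) = rep i

    tree-of′ : ∀ {u} → u ∈ L → head (code u) ∈ k ∷ ks → Σ _ λ i → key′ i ≡ head (code u)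
    tree-of′ u∈ (here eq)  = zero , ≡-sym eq
    tree-of′ u∈ (there k∈) with tree-of u∈ k∈
    ... | i , eq = suc i , eq

  skip : ∀ {h} {code : V → Vec Key (suc h)} {L k ks} →
    (∀ {u} → u ∈ L → head (code u) ≡ k → k ∈ ks) → Forest code L ks → Forest code L (k ∷ ks)
  skip old F = record
    { trees = trees ; key = key ; key∈ = there ∘ key∈ ; key-inj = key-inj ; rep = rep
    ; tree-of = λ { u∈ (here eq)  → tree-of u∈ (subst (_∈ _) (≡-sym eq) (old u∈ eq))
                  ; u∈ (there k∈) → tree-of u∈ k∈ } }
    where open Forest F

  -- Every cotree has a leaf, so a key without vertices must be skipped; a key occurring again later
  -- in the list is left to that occurrence.
  forest : ∀ {h} {code : V → Vec Key (suc h)} {L} →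
    (∀ {k u} → u ∈ first code k L → Σ (Cotree h) λ T → Represents T (first code k L)) →
    ∀ ks → Forest code L ks
  forest subtree [] = record
    { trees = [] ; key = λ () ; key∈ = λ () ; key-inj = λ {} ; rep = λ () ; tree-of = λ _ () }
  forest {code = code} {L} subtree (k ∷ ks)
    with any? (k ≟ₖ_) ks | any? (λ u → head (code u) ≟ₖ k) L
  ... | yes k∈ | _     = skip (λ _ _ → k∈) (forest subtree ks)
  ... | no _   | no ∄u = skip (λ u∈ eq → contradiction (lose u∈ eq) ∄u) (forest subtree ks)
  ... | no k∉  | yes ∃u with find ∃u
  ... | u , u∈ , eq =
    plant k∉ (subtree (∈-filter⁺ (λ u → head (code u) ≟ₖ k) u∈ eq)) (forest subtree ks)

  join-forest : ∀ {b h} {code : V → Vec Key (suc h)} {L u} → RealisedBy b code L → u ∈ L →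
    Forest code L (map (head ∘ code) L) → Σ (Cotree (suc h)) λ T → Represents T L
  -- `node` needs at least one child; the first key of `u` provides it.
  join-forest {u = u} _ u∈ record { trees = [] ; tree-of = tree-of }
    with () ← proj₁ (tree-of u∈ (∈-map⁺ _ u∈))
  join-forest {b} {h} {code} {L} codes _
    record { trees = T ∷ Ts ; key = key ; key-inj = key-inj ; rep = rep ; tree-of = tree-of } =
    node b (T ∷ Ts) , record
      { vertex = vertex′ ; vertex∈ = vertex′∈ ; vertex-inj = λ {x} {y} → vertex′-inj x y
      ; leaf-of = leaf-of′ ; adj≡ = adj≡′ }
    where
    vertex′ : Leaf (node b (T ∷ Ts)) → V
    vertex′ (there i x) = vertex (rep i) x

    first⁻ : ∀ i x → vertex (rep i) x ∈ L × head (code (vertex (rep i) x)) ≡ key i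
    first⁻ i x = ∈-filter⁻ (λ u → head (code u) ≟ₖ key i) (vertex∈ (rep i) x)

    vertex′∈ : ∀ x → vertex′ x ∈ L
    vertex′∈ (there i x) = proj₁ (first⁻ i x)

    same-key : ∀ {i j} x y → head (code (vertex (rep i) x)) ≡ head (code (vertex (rep j) y)) → i ≡ j
    same-key {i} {j} x y eq =
      key-inj (trans (≡-sym (proj₂ (first⁻ i x))) (trans eq (proj₂ (first⁻ j y))))

    vertex′-inj : ∀ x y → vertex′ x ≡ vertex′ y → x ≡ y
    vertex′-inj (there i x) (there j y) eq with same-key x y (cong (head ∘ code) eq)
    ... | refl = cong (there i) (vertex-inj (rep i) eq)

    leaf-of′ : ∀ {u} → u ∈ L → Σ (Leaf (node b (T ∷ Ts))) λ x → vertex′ x ≡ u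
    leaf-of′ u∈ with tree-of u∈ (∈-map⁺ _ u∈)
    ... | i , eq with leaf-of (rep i) (∈-filter⁺ (λ u → head (code u) ≟ₖ key i) u∈ (≡-sym eq))
    ... | x , vx = there i x , vx

    root-label : ∀ {u v} → u ∈ L → v ∈ L → head (code u) ≢ head (code v) → adj G u v ≡ b
    root-label {u} {v} u∈ v∈ k≢ with code u | code v | codes u∈ v∈ (k≢ ∘ cong (head ∘ code)) | k≢
    ... | _ ∷ _ | _ ∷ _ | _ , label | k≢′ = label k≢′

    adj≡′ : ∀ x y → cotreeAdj x y ≡ adj G (vertex′ x) (vertex′ y)
    adj≡′ (there i x) (there j y) with i ≟ j
    ... | yes refl = adj≡ (rep i) x y
    ... | no i≢j   = ≡-sym (root-label (proj₁ (first⁻ i x)) (proj₁ (first⁻ j y)) (i≢j ∘ same-key x y))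

  cotree : ∀ b {h} (code : V → Vec Key h) {L u} → RealisedBy b code L → u ∈ L →
           Σ (Cotree h) λ T → Represents T L
  -- `Codes` of empty vectors is `⊥`, so `L` has no two distinct vertices and a leaf suffices.
  cotree b {zero} code {L} {u} codes u∈ = leaf , record
    { vertex     = λ _ → u
    ; vertex∈    = λ _ → u∈
    ; vertex-inj = λ { {here} {here} _ → refl }
    ; leaf-of    = λ v∈ → here , all-equal u∈ v∈
    ; adj≡       = λ { here here → ≡-sym (irrefl G u) } }
    where
    all-equal : ∀ {v w} → v ∈ L → w ∈ L → v ≡ w
    all-equal {v} {w} v∈ w∈ with v ≟ w
    ... | yes v≡w = v≡w
    ... | no v≢w with code v | code w | codes v∈ w∈ v≢w
    ... | [] | [] | ()
  cotree b {suc h} code {L} codes u∈ = join-forest codes u∈ (forest subtree _)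
    where
    tails : ∀ k → RealisedBy (not b) (tail ∘ code) (first code k L)
    tails k {v} {w} v∈ w∈ v≢w
      with ∈-filter⁻ (λ u → head (code u) ≟ₖ k) {xs = L} v∈
         | ∈-filter⁻ (λ u → head (code u) ≟ₖ k) {xs = L} w∈
    ... | v∈L , eq | w∈L , eq′ with code v | code w | codes v∈L w∈L v≢w
    ... | _ ∷ _ | _ ∷ _ | below , _ = below (trans eq (≡-sym eq′))

    subtree : ∀ {k u} → u ∈ first code k L → Σ (Cotree h) λ T → Represents T (first code k L)
    subtree {k} = cotree (not b) (tail ∘ code) (tails k)

  -- The cosplit of the whole graph.

  split⇒cosplit : ∀ {b h m} → Split b h m (allFin (n G)) → HasCosplit G (suc m) h
  split⇒cosplit {b} s = part s , λ v → cograph v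
    where
    cograph : ∀ v → IsCographOfHeight≤ G (λ u → part s u ≡ part s v) _
    cograph v = T , mk↔ₛ′ to from to∘from from∘to , adj≡ R
      where
      in-part? : ∀ u → Dec (part s u ≡ part s v)
      in-part? u = part s u ≟ part s v

      L = filter in-part? (allFin (n G))

      L⁺ : ∀ {u} → part s u ≡ part s v → u ∈ L
      L⁺ = ∈-filter⁺ in-part? (∈-allFin _)

      L⁻ : ∀ {u} → u ∈ L → part s u ≡ part s v
      L⁻ = proj₂ ∘ ∈-filter⁻ in-part? {xs = allFin (n G)}

      TR : Σ (Cotree _) λ T → Represents T L
      TR = cotree b (code s)
        (λ u∈ w∈ u≢w → codes s (∈-allFin _) (∈-allFin _) u≢w (trans (L⁻ u∈) (≡-sym (L⁻ w∈))))
        -- The part of `v` is nonempty because it contains `v`.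
        (L⁺ {v} refl)

      T = proj₁ TR
      R = proj₂ TR

      Part : Set
      Part = Σ V λ u → part s u ≡ part s v

      to : Leaf T → Part
      to x = vertex R x , L⁻ (vertex∈ R x)

      from : Part → Leaf T
      from (u , p) = proj₁ (leaf-of R (L⁺ p))

      Part-≡ : {x y : Part} → proj₁ x ≡ proj₁ y → x ≡ y
      Part-≡ {u , p} {_ , q} refl = cong (u ,_) (Decidable⇒UIP.≡-irrelevant _≟_ p q)

      to∘from : ∀ y → to (from y) ≡ y
      to∘from (u , p) = Part-≡ (proj₂ (leaf-of R (L⁺ p)))

      from∘to : ∀ x → from (to x) ≡ x
      from∘to x = vertex-inj R (proj₂ (leaf-of R (L⁺ _)))

theorem1p8 : (t k : ℕ) → Σ ℕ λ N → (G : Graph) →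
    ¬ IsInducedSubgraph t (pathAdj t) G →
    ¬ IsInducedSubgraph t (coPathAdj t) G →
    ¬ IsInducedSubgraph (k + k) (RAdj k) G →
    HasCosplit G N (4 * k)
-- The `suc` turns parts minus one into parts. One level per term of the excluded sequence gives
-- height `4 * k`.
theorem1p8 t k = suc (colours t (4 * k)) , λ G no-path no-copath no-R →
  split⇒cosplit G (alt-free-split G
    (λ { {true}  p len → no-path (subst (λ s → IsInducedSubgraph s (pathAdj s) G) len (path-induced G p))
       ; {false} p len → no-copath (subst (λ s → IsInducedSubgraph s (coPathAdj s) G) len (copath-induced G p)) })
    (4 * k)
    -- A sequence of length `4 * k` is truncated to its first `k * 2` terms, which form R_k.
    (λ alt → no-R (threshold-induced G (threshold G k (Alt-≤ G 2k≤4k alt)))))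
  where
  2k≤4k : k * 2 ≤ 4 * k
  2k≤4k = subst (k * 2 ≤_) (*-comm k 4) (*-monoʳ-≤ k (s≤s (s≤s z≤n)))
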